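{- Let $n\ge1$. (i) Suppose $\mathcal{C}\subseteq\mathbb{F}_2^{n+1}$ is a union $\mathcal{C}=\bigcup_{i=0}^{\lfloor n/2\rfloor}\mathcal{C}_i$, where for each $i$, $\mathcal{C}_i$ is a covering design $\mathcal{C}(n+1,\,n+1-2i,\,n-2i)$ (a set of vectors of weight $n+1-2i$ such that every vector of weight $n-2i$ is covered by one of them). Then deleting any one fixed coordinate from all vectors of $\mathcal{C}$ yields a banded asymmetric covering $\mathcal{D}(n,1)$. (ii) Conversely, let $\mathcal{D}\subseteq\mathbb{F}_2^n$ be a banded asymmetric covering $\mathcal{D}(n,1)$. Append to each vector of $\mathcal{D}$ a final bit $0$ or $1$ chosen so that the resulting vector of length $n+1$ has even co-weight. Then, for each $0\le i\le\lfloor n/2\rfloor$, the resulting vectors of weight $n+1-2i$ form a covering design $\mathcal{C}(n+1,n+1-2i,n-2i)$.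
   Context: Subsets are identified with indicator vectors; weight is Hamming weight and the co-weight of $u\in\mathbb{F}_2^n$ is $n-\mathrm{wt}(u)$. A vector $u$ covers $v$ if the support of $v$ is contained in that of $u$. An asymmetric covering $\mathcal{D}(n,1)$ is a set $\mathcal{D}\subseteq\mathbb{F}_2^n$ such that every $v\in\mathbb{F}_2^n$ either lies in $\mathcal{D}$ or is covered by some $u\in\mathcal{D}$ with $\mathrm{wt}(u)=\mathrm{wt}(v)+1$. It is banded if every $v\in\mathbb{F}_2^n$ of odd co-weight is covered by some $u\in\mathcal{D}$ with $\mathrm{wt}(u)=\mathrm{wt}(v)+1$. A covering design $\mathcal{C}(v,k,t)$ is a collection of $k$-subsets of a $v$-set such that every $t$-subset is contained in at least one of them. -}

module Defs where

open import Level using (Level)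
open import Data.Nat.Base using (ℕ; suc; _+_; _∸_)
open import Data.Nat.Divisibility using (_∣_; _∤_)
open import Data.Fin.Base using (Fin)
open import Data.Fin.Subset using (Subset; ∣_∣; _⊆_)
open import Data.Product.Base using (_×_; ∃-syntax)
open import Data.Sum.Base using (_⊎_)
open import Data.Vec.Base using (_∷ʳ_; removeAt)
open import Relation.Binary.PropositionalEquality.Core using (_≡_)
open import Relation.Unary using (Pred; _∈_)

-- Vectors in 𝔽₂ⁿ are the Boolean vectors `Subset n`, with `inside` for 1 and
-- `outside` for 0, so that Hamming weight is `∣_∣` and `u` covers `v` when
-- `v ⊆ u`.  Sets of vectors are unary predicates.

coweight : ∀ {n} → Subset n → ℕ
coweight {n} u = n ∸ ∣ u ∣

CoveredFromAbove : ∀ {n} {ℓ : Level} → Pred (Subset n) ℓ → Subset n → Set ℓ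
CoveredFromAbove D v = ∃[ u ] (u ∈ D × v ⊆ u × ∣ u ∣ ≡ ∣ v ∣ + 1)

AsymmetricCovering : ∀ {n} {ℓ : Level} → Pred (Subset n) ℓ → Set ℓ
AsymmetricCovering D = ∀ v → v ∈ D ⊎ CoveredFromAbove D v

Banded : ∀ {n} {ℓ : Level} → Pred (Subset n) ℓ → Set ℓ
Banded D = ∀ v → 2 ∤ coweight v → CoveredFromAbove D v

BandedAsymmetricCovering : ∀ {n} {ℓ : Level} → Pred (Subset n) ℓ → Set ℓ
BandedAsymmetricCovering D = AsymmetricCovering D × Banded D

CoveringDesign : ∀ {ℓ : Level} (v k t : ℕ) → Pred (Subset v) ℓ → Set ℓ
CoveringDesign v k t C =
  (∀ B → B ∈ C → ∣ B ∣ ≡ k) ×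
  (∀ (T : Subset v) → ∣ T ∣ ≡ t → ∃[ B ] (B ∈ C × T ⊆ B))

deleteCoordinate : ∀ {n} {ℓ : Level} → Fin (suc n) →
                   Pred (Subset (suc n)) ℓ → Pred (Subset n) ℓ
deleteCoordinate j C u = ∃[ c ] (c ∈ C × u ≡ removeAt c j)

-- For each `u` exactly one choice of the bit `b` makes the co-weight even.
appendEven : ∀ {n} {ℓ : Level} →
             Pred (Subset n) ℓ → Pred (Subset (suc n)) ℓ
appendEven D w =
  ∃[ u ] ∃[ b ] (u ∈ D × w ≡ u ∷ʳ b × 2 ∣ coweight w)

ofWeight : ∀ {n} → ℕ → Pred (Subset n) Level.zero
ofWeight k w = ∣ w ∣ ≡ k

{-# OPTIONS --safe #-}
-- Covering designs with the parameters of the theorem amount to one condition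
-- on a set of vectors of length n + 1: being banded, the vectors of weight
-- n - 2i being exactly those of co-weight 2i + 1.  Deleting a coordinate and
-- appending an even-making bit both transport this condition.  To cover v after
-- deletion, put a 1 (odd co-weight) or a 0 (even co-weight) at the deleted place
-- and cover the longer vector; in the second case the cover may be v with a 1
-- put there, and then v itself belongs to the shortened set.
module Submission where

open import Defs
open import Level using (Level)
open import Data.Nat.Base using (ℕ; zero; suc; _+_; _*_; _∸_; _≤_; s≤s; s≤s⁻¹; ⌊_/2⌋)
open import Data.Nat.Properties
open import Data.Nat.Divisibility using (_∣_; _∤_; _∣?_; divides; m∣m*n; ∣m+n∣m⇒∣n; ∣1⇒≡1; _∣0)
open import Data.Fin.Base using (Fin; zero; suc; toℕ; fromℕ<)
open import Data.Fin.Properties using (toℕ-fromℕ<)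
open import Data.Fin.Subset using (Subset; inside; outside; ∣_∣; _⊆_)
open import Data.Fin.Subset.Properties
  using (drop-∷-⊆; out⊆; in⊆in; ∣p∣≤n; p⊆q⇒∣p∣≤∣q∣)
open import Data.Product.Base using (_×_; _,_; proj₁; proj₂; ∃-syntax)
open import Data.Sum.Base using (inj₁; inj₂)
open import Data.Vec.Base
  using ([]; _∷_; _∷ʳ_; here; there; lookup; insertAt; removeAt; initLast)
open import Relation.Binary.PropositionalEquality
open import Relation.Nullary.Decidable using (yes; no)
open import Relation.Nullary.Negation using (contradiction)
open import Relation.Unary using (Pred; _≐_; _∩_; ⋃; _∈_)

private
  variable
    ℓ : Level
    n : ℕ

-- Parity and halving.

∤⇒≡1+2* : ∀ m → 2 ∤ m → ∃[ i ] m ≡ suc (2 * i)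
∤⇒≡1+2* zero 2∤0 = contradiction (2 ∣0) 2∤0
∤⇒≡1+2* (suc zero) _ = 0 , refl
∤⇒≡1+2* (suc (suc m)) 2∤2+m
  with ∤⇒≡1+2* m (λ { (divides q eq) → 2∤2+m (divides (suc q) (cong (2 +_) eq)) })
... | i , refl = suc i , cong suc (sym (*-suc 2 i))

2∣m⇒2∤1+m : ∀ {m} → 2 ∣ m → 2 ∤ suc m
2∣m⇒2∤1+m {m} 2∣m 2∣1+m with () ← ∣1⇒≡1 (∣m+n∣m⇒∣n (subst (2 ∣_) (+-comm 1 m) 2∣1+m) 2∣m)

2∤1+m⇒2∣m : ∀ {m} → 2 ∤ suc m → 2 ∣ m
2∤1+m⇒2∣m 2∤1+m with ∤⇒≡1+2* _ 2∤1+m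
... | i , refl = m∣m*n i

2*i≤n⇒i≤⌊n/2⌋ : ∀ i → 2 * i ≤ n → i ≤ ⌊ n /2⌋
2*i≤n⇒i≤⌊n/2⌋ {n} i 2i≤n = begin
  i            ≡⟨ n≡⌊n+n/2⌋ i ⟩
  ⌊ i + i /2⌋  ≤⟨ ⌊n/2⌋-mono (subst (_≤ n) (cong (i +_) (+-identityʳ i)) 2i≤n) ⟩
  ⌊ n /2⌋      ∎
  where open ≤-Reasoning

i≤⌊n/2⌋⇒2*i≤n : ∀ {i} → i ≤ ⌊ n /2⌋ → 2 * i ≤ n
i≤⌊n/2⌋⇒2*i≤n {n} {i} i≤ = begin
  2 * i                    ≡⟨ cong (i +_) (+-identityʳ i) ⟩
  i + i                    ≤⟨ +-mono-≤ i≤ (≤-trans i≤ (⌊n/2⌋≤⌈n/2⌉ n)) ⟩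
  ⌊ n /2⌋ + _              ≡⟨ ⌊n/2⌋+⌈n/2⌉≡n n ⟩
  n                        ∎
  where open ≤-Reasoning

-- Weight and containment under moving a coordinate.

∣∷∣-cong : ∀ x {m} (p : Subset n) (q : Subset m) → ∣ p ∣ ≡ ∣ q ∣ → ∣ x ∷ p ∣ ≡ ∣ x ∷ q ∣
∣∷∣-cong inside  p q eq = cong suc eq
∣∷∣-cong outside p q eq = eq

∣∷∣-swap : ∀ x y (p : Subset n) → ∣ x ∷ y ∷ p ∣ ≡ ∣ y ∷ x ∷ p ∣
∣∷∣-swap inside  inside  p = refl
∣∷∣-swap inside  outside p = refl
∣∷∣-swap outside inside  p = refl
∣∷∣-swap outside outside p = refl

∣∷ʳ∣ : ∀ (p : Subset n) b → ∣ p ∷ʳ b ∣ ≡ ∣ b ∷ p ∣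
∣∷ʳ∣ []      b = refl
∣∷ʳ∣ (x ∷ p) b = trans (∣∷∣-cong x (p ∷ʳ b) (b ∷ p) (∣∷ʳ∣ p b)) (∣∷∣-swap x b p)

∣insertAt∣ : ∀ (p : Subset n) j b → ∣ insertAt p j b ∣ ≡ ∣ b ∷ p ∣
∣insertAt∣ p       zero    b = refl
∣insertAt∣ (x ∷ p) (suc j) b =
  trans (∣∷∣-cong x (insertAt p j b) (b ∷ p) (∣insertAt∣ p j b))
        (∣∷∣-swap x b p)

∣lookup∷removeAt∣ : ∀ (p : Subset (suc n)) j → ∣ lookup p j ∷ removeAt p j ∣ ≡ ∣ p ∣
∣lookup∷removeAt∣ (x ∷ p)       zero    = refl
-- The tail is matched as nonempty so that `removeAt` at `suc j` computes.
∣lookup∷removeAt∣ (x ∷ p@(_ ∷ _)) (suc j) =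
  trans (∣∷∣-swap (lookup p j) x (removeAt p j))
        (∣∷∣-cong x (lookup p j ∷ removeAt p j) p (∣lookup∷removeAt∣ p j))

-- Only the heads of the first containment matter, so its tails may have another length.
-- Containments can thus be reassembled coordinate by coordinate after a permutation.
replace-tail-⊆ : ∀ {m x y} {p q : Subset m} {p′ q′ : Subset n} →
                 x ∷ p ⊆ y ∷ q → p′ ⊆ q′ → x ∷ p′ ⊆ y ∷ q′
replace-tail-⊆ h t here with here ← h here = here
replace-tail-⊆ h t (there x∈p′) = there (t x∈p′)

∷⊆∷⇒∷ʳ⊆∷ʳ : ∀ {b c} {p q : Subset n} → b ∷ p ⊆ c ∷ q → p ∷ʳ b ⊆ q ∷ʳ c
∷⊆∷⇒∷ʳ⊆∷ʳ {p = []}    {[]}    h = h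
∷⊆∷⇒∷ʳ⊆∷ʳ {p = _ ∷ _} {_ ∷ _} h =
  replace-tail-⊆ (drop-∷-⊆ h)
    (∷⊆∷⇒∷ʳ⊆∷ʳ (replace-tail-⊆ h (drop-∷-⊆ (drop-∷-⊆ h))))

-- With place `j` moved to the front, a case split on the bit to be deleted becomes a comparison of
-- heads.
insertAt⊆⇒∷⊆lookup∷removeAt : ∀ (p : Subset n) j b (q : Subset (suc n)) →
  insertAt p j b ⊆ q → b ∷ p ⊆ lookup q j ∷ removeAt q j
insertAt⊆⇒∷⊆lookup∷removeAt p       zero    b (y ∷ q) h = h
insertAt⊆⇒∷⊆lookup∷removeAt (x ∷ p) (suc j) b (y ∷ q@(_ ∷ _)) h =
  replace-tail-⊆ ih (replace-tail-⊆ h (drop-∷-⊆ ih))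
  where
  ih : b ∷ p ⊆ lookup q j ∷ removeAt q j
  ih = insertAt⊆⇒∷⊆lookup∷removeAt p j b q (drop-∷-⊆ h)

⊆∧∣≡∣⇒≡ : ∀ (p q : Subset n) → p ⊆ q → ∣ p ∣ ≡ ∣ q ∣ → p ≡ q
⊆∧∣≡∣⇒≡ []            []            _ _ = refl
⊆∧∣≡∣⇒≡ (inside  ∷ p) (inside  ∷ q) h eq =
  cong (inside ∷_) (⊆∧∣≡∣⇒≡ p q (drop-∷-⊆ h) (suc-injective eq))
⊆∧∣≡∣⇒≡ (inside  ∷ p) (outside ∷ q) h eq with () ← h here
⊆∧∣≡∣⇒≡ (outside ∷ p) (inside  ∷ q) h eq =
  -- Here `eq` says `∣ p ∣ ≡ suc ∣ q ∣`, although `p ⊆ q`.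
  contradiction (p⊆q⇒∣p∣≤∣q∣ (drop-∷-⊆ h)) (<⇒≱ (≤-reflexive (sym eq)))
⊆∧∣≡∣⇒≡ (outside ∷ p) (outside ∷ q) h eq =
  cong (outside ∷_) (⊆∧∣≡∣⇒≡ p q (drop-∷-⊆ h) eq)

coweight-outside∷ : ∀ (p : Subset n) → coweight (outside ∷ p) ≡ suc (coweight p)
coweight-outside∷ p = +-∸-assoc 1 (∣p∣≤n p)

-- Passing to a cover flips the parity of the co-weight, so covers of odd vectors satisfy the
-- evenness in `appendEven`.
coweight-cover : ∀ (p q : Subset n) → ∣ q ∣ ≡ ∣ p ∣ + 1 → coweight p ≡ suc (coweight q)
coweight-cover {n} p q eq =
  trans (cong (suc n ∸_) (sym (trans eq (+-comm ∣ p ∣ 1)))) (+-∸-assoc 1 (∣p∣≤n q))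

-- Covering designs and bandedness.

designs⇒Banded : {C : Pred (Subset (suc n)) ℓ}
  (Cᵢ : Fin (suc ⌊ n /2⌋) → Pred (Subset (suc n)) ℓ) →
  C ≐ ⋃ (Fin (suc ⌊ n /2⌋)) Cᵢ →
  (∀ i → CoveringDesign (suc n) (suc n ∸ 2 * toℕ i) (n ∸ 2 * toℕ i) (Cᵢ i)) →
  Banded C
designs⇒Banded {n} Cᵢ (_ , ⋃⊆C) design T odd
  with i , cw≡1+2i ← ∤⇒≡1+2* (coweight T) odd
  = cover
  where
  2i≤n : 2 * i ≤ n
  -- The co-weight `suc (2 * i)` is at most `suc n`, which puts `i` in the range of the designs.
  2i≤n = s≤s⁻¹ (subst (_≤ suc n) cw≡1+2i (m∸n≤m (suc n) ∣ T ∣))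

  i<  = s≤s (2*i≤n⇒i≤⌊n/2⌋ i 2i≤n)
  i′  = fromℕ< i<
  i′≡i = toℕ-fromℕ< i<

  ∣T∣≡ : ∣ T ∣ ≡ n ∸ 2 * toℕ i′
  ∣T∣≡ = begin
    ∣ T ∣                    ≡⟨ m∸[m∸n]≡n (∣p∣≤n T) ⟨
    suc n ∸ coweight T       ≡⟨ cong (suc n ∸_) cw≡1+2i ⟩
    n ∸ 2 * i                ≡⟨ cong (λ k → n ∸ 2 * k) i′≡i ⟨
    n ∸ 2 * toℕ i′           ∎
    where open ≡-Reasoning

  cover : CoveredFromAbove _ T
  cover with B , B∈Cᵢ , T⊆B ← proj₂ (design i′) T ∣T∣≡ =
    B , ⋃⊆C (i′ , B∈Cᵢ) , T⊆B , (begin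
      ∣ B ∣                    ≡⟨ proj₁ (design i′) B B∈Cᵢ ⟩
      -- Subtraction is truncated: `suc` can be pulled out because `2 * i ≤ n`.
      suc n ∸ 2 * toℕ i′       ≡⟨ +-∸-assoc 1 (subst (λ k → 2 * k ≤ n) (sym i′≡i) 2i≤n) ⟩
      suc (n ∸ 2 * toℕ i′)     ≡⟨ cong suc ∣T∣≡ ⟨
      suc ∣ T ∣                ≡⟨ +-comm 1 ∣ T ∣ ⟩
      ∣ T ∣ + 1                ∎)
    where open ≡-Reasoning

Banded⇒design : {C : Pred (Subset (suc n)) ℓ} → Banded C → ∀ {i} → i ≤ ⌊ n /2⌋ →
  CoveringDesign (suc n) (suc n ∸ 2 * i) (n ∸ 2 * i) (C ∩ ofWeight (suc n ∸ 2 * i))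
Banded⇒design {n} {C = C} banded {i} i≤ = (λ _ → proj₂) , covers
  where
  2i≤n : 2 * i ≤ n
  2i≤n = i≤⌊n/2⌋⇒2*i≤n i≤

  covers : ∀ T → ∣ T ∣ ≡ n ∸ 2 * i → ∃[ B ] (B ∈ C ∩ ofWeight (suc n ∸ 2 * i) × T ⊆ B)
  covers T ∣T∣≡ =
    let B , B∈C , T⊆B , ∣B∣≡ = banded T (subst (2 ∤_) (sym coweight-T) (2∣m⇒2∤1+m (m∣m*n i)))
    in B , (B∈C , trans ∣B∣≡ weight-B) , T⊆B
    where
    open ≡-Reasoning
    coweight-T : coweight T ≡ suc (2 * i)
    coweight-T = begin
      suc n ∸ ∣ T ∣            ≡⟨ cong (suc n ∸_) ∣T∣≡ ⟩
      suc n ∸ (n ∸ 2 * i)      ≡⟨ +-∸-assoc 1 (m∸n≤m n (2 * i)) ⟩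
      suc (n ∸ (n ∸ 2 * i))    ≡⟨ cong suc (m∸[m∸n]≡n 2i≤n) ⟩
      suc (2 * i)              ∎
    weight-B : ∣ T ∣ + 1 ≡ suc n ∸ 2 * i
    weight-B = begin
      ∣ T ∣ + 1                ≡⟨ +-comm ∣ T ∣ 1 ⟩
      suc ∣ T ∣                ≡⟨ cong suc ∣T∣≡ ⟩
      suc (n ∸ 2 * i)          ≡⟨ +-∸-assoc 1 2i≤n ⟨
      suc n ∸ 2 * i            ∎

-- Deleting and appending a coordinate.

deleteCoordinate-banded : {C : Pred (Subset (suc n)) ℓ} → Banded C →
  ∀ j → BandedAsymmetricCovering (deleteCoordinate j C)
deleteCoordinate-banded {n} {C = C} banded j = asymmetric , banded′
  where
  coverInserted : ∀ v b → 2 ∤ coweight (b ∷ v) → ∃[ B ] (B ∈ C ×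
    b ∷ v ⊆ lookup B j ∷ removeAt B j × ∣ lookup B j ∷ removeAt B j ∣ ≡ ∣ b ∷ v ∣ + 1)
  coverInserted v b odd
    with B , B∈C , T⊆B , ∣B∣≡ ← banded (insertAt v j b)
           (subst (2 ∤_) (sym (cong (suc n ∸_) (∣insertAt∣ v j b))) odd)
    = B , B∈C , insertAt⊆⇒∷⊆lookup∷removeAt v j b B T⊆B ,
      trans (∣lookup∷removeAt∣ B j) (trans ∣B∣≡ (cong (_+ 1) (∣insertAt∣ v j b)))

  banded′ : Banded (deleteCoordinate j C)
  banded′ v odd
    -- A 1 adds equally to length and weight, so `inside ∷ v` has the co-weight of `v` by
    -- computation.
    with B , B∈C , s , w ← coverInserted v inside odd
    with lookup B j | s | w
  ... | inside  | s | w =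
    removeAt B j , (B , B∈C , refl) , drop-∷-⊆ s , suc-injective w
  ... | outside | s | w with () ← s here

  asymmetric : AsymmetricCovering (deleteCoordinate j C)
  asymmetric v with 2 ∣? coweight v
  ... | no  odd  = inj₂ (banded′ v odd)
  ... | yes even
    with B , B∈C , s , w ← coverInserted v outside
           (subst (2 ∤_) (sym (coweight-outside∷ v)) (2∣m⇒2∤1+m even))
    with lookup B j | s | w
  ... | inside  | s | w =
    -- The 1 at the deleted place uses up the extra weight, so the rest of `B` contains `v`, has its
    -- weight, and equals it.
    inj₁ (B , B∈C , ⊆∧∣≡∣⇒≡ v _ (drop-∷-⊆ s) (suc-injective (trans (+-comm 1 ∣ v ∣) (sym w))))
  ... | outside | s | w = inj₂ (removeAt B j , (B , B∈C , refl) , drop-∷-⊆ s , w)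

-- The last bit of `T` selects the property of `D`: after a 1 the remaining `v` has odd co-weight
-- and bandedness applies; after a 0 the asymmetric covering is used.
appendEven-banded : {D : Pred (Subset n) ℓ} → BandedAsymmetricCovering D → Banded (appendEven D)
appendEven-banded {n} {D = D} (asymmetric , banded) T odd with initLast T
... | v , b , refl = coverLast b odd
  where
  coweight-∷ʳ : ∀ b → coweight (v ∷ʳ b) ≡ coweight (b ∷ v)
  coweight-∷ʳ b = cong (suc n ∸_) (∣∷ʳ∣ v b)

  extend : ∀ {b} → 2 ∤ coweight (v ∷ʳ b) → ∀ u c → u ∈ D →
           b ∷ v ⊆ c ∷ u → ∣ c ∷ u ∣ ≡ ∣ b ∷ v ∣ + 1 → CoveredFromAbove (appendEven D) (v ∷ʳ b)
  extend {b} odd u c u∈D s w = u ∷ʳ c , (u , c , u∈D , refl , even) , ∷⊆∷⇒∷ʳ⊆∷ʳ s , w′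
    where
    w′ : ∣ u ∷ʳ c ∣ ≡ ∣ v ∷ʳ b ∣ + 1
    w′ = trans (∣∷ʳ∣ u c) (trans w (cong (_+ 1) (sym (∣∷ʳ∣ v b))))
    even : 2 ∣ coweight (u ∷ʳ c)
    even = 2∤1+m⇒2∣m (subst (2 ∤_) (coweight-cover (v ∷ʳ b) (u ∷ʳ c) w′) odd)

  coverLast : ∀ b → 2 ∤ coweight (v ∷ʳ b) → CoveredFromAbove (appendEven D) (v ∷ʳ b)
  coverLast inside odd
    with u , u∈D , v⊆u , w ← banded v (subst (2 ∤_) (coweight-∷ʳ inside) odd)
    = extend odd u inside u∈D (in⊆in v⊆u) (cong suc w)
  coverLast outside odd with asymmetric v
  -- The cover is `v` itself with its final 0 raised to 1.
  ... | inj₁ v∈D                 = extend odd v inside v∈D (out⊆ λ x∈v → x∈v) (+-comm 1 ∣ v ∣)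
  ... | inj₂ (u , u∈D , v⊆u , w) = extend odd u outside u∈D (out⊆ v⊆u) w

theorem3 : ∀ {ℓ : Level} (n : ℕ) → 1 ≤ n →
    ( (C : Pred (Subset (suc n)) ℓ)
    (Cᵢ : Fin (suc ⌊ n /2⌋) → Pred (Subset (suc n)) ℓ) →
    C ≐ ⋃ (Fin (suc ⌊ n /2⌋)) Cᵢ →
    (∀ i → CoveringDesign (suc n) (suc n ∸ 2 * toℕ i) (n ∸ 2 * toℕ i) (Cᵢ i)) →
    (j : Fin (suc n)) → BandedAsymmetricCovering (deleteCoordinate j C) )
    ×
    ( (D : Pred (Subset n) ℓ) → BandedAsymmetricCovering D →
    (i : ℕ) → i ≤ ⌊ n /2⌋ →
    CoveringDesign (suc n) (suc n ∸ 2 * i) (n ∸ 2 * i)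
    (appendEven D ∩ ofWeight (suc n ∸ 2 * i)) )
theorem3 n _ =
  (λ C Cᵢ C≐⋃Cᵢ designs → deleteCoordinate-banded (designs⇒Banded Cᵢ C≐⋃Cᵢ designs)) ,
  (λ D covering i i≤ → Banded⇒design (appendEven-banded covering) i≤)
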